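{- Let $n\ge 2$ and $\mathbf{y}=(y_1,y_2,\dots,y_n)\in\mathbb{N}^n$. Then $\chi(\mathbf{y})=n-1$ if and only if $$y_1\ge y_2\quad\text{and}\quad y_2=y_3=\cdots=y_n.$$
   Context: $\mathbb{N}=\{1,2,3,\dots\}$ and $[n]=\{1,\dots,n\}$. Let $\mathbf{y}=(y_1,\dots,y_n)\in\mathbb{N}^n$ and $m=\sum_{i=1}^n y_i$. Consider a one-way street with $m$ parking spots numbered $1,\dots,m$ and $n$ cars entering in order $1,2,\dots,n$, where car $i$ has length $y_i$ and prefers spot $x_i\in[m]$. Car $i$ drives to spot $x_i$ and parks in $x_i,x_i+1,\dots,x_i+y_i-1$ if these spots exist and are all unoccupied; otherwise it parks in the next $y_i$ contiguous available spots, i.e. it occupies $s,s+1,\dots,s+y_i-1$ for the smallest $s\ge x_i$ such that $s+y_i-1\le m$ and all these spots are unoccupied; if no such $s$ exists, parking fails. The vector $\mathbf{x}=(x_1,\dots,x_n)\in[m]^n$ is a parking assortment for $\mathbf{y}$ if all cars can park; the set of these is $\mathsf{PA}_n(\mathbf{y})$. A parking assortment $\mathbf{x}$ is (permutation) invariant if every permutation of its entries is also in $\mathsf{PA}_n(\mathbf{y})$; $\mathsf{PA}^{\mathrm{inv}}_n(\mathbf{y})$ is the set of invariant parking assortments for $\mathbf{y}$. For $\mathbf{x}\in\mathsf{PA}^{\mathrm{inv}}_n(\mathbf{y})$ the degree is $\deg\mathbf{x}=|\{i\in[n]:x_i\ne 1\}|$, and the characteristic of $\mathbf{y}$ is $\chi(\mathbf{y})=\max_{\mathbf{z}\in\mathsf{PA}^{\mathrm{inv}}_n(\mathbf{y})}\deg\mathbf{z}$.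 -}

module Defs where

open import Data.Fin as Fin using (Fin; zero; suc)
import Data.Fin.Properties as Fin
open import Data.Fin.Permutation as Perm
  using (Permutation′; _⟨$⟩ʳ_; insert; remove; insert-remove)
open import Data.List as List using (List)
import Data.List.Extrema.Nat as Extrema
open import Data.List.Membership.Propositional using (_∈_; find; lose)
open import Data.List.Membership.Propositional.Properties
  using (∈-map⁺; ∈-map⁻; ∈-upTo⁺; ∈-upTo⁻; ∈-cartesianProductWith⁺;
         ∈-cartesianProductWith⁻; ∈-filter⁺; ∈-filter⁻)
import Data.List.Relation.Unary.All as ListAll
open import Data.List.Relation.Unary.Any as Any using (here)
open import Data.Nat using (ℕ; zero; suc; _+_; _∸_; _≤_; _<_; z≤n; s≤s; _≤?_; _<?_; _≟_)
open import Data.Nat.Properties using (allUpTo?; n≤0⇒n≡0; ≤-trans; ≤-reflexive)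
open import Data.Product using (∃; _×_; _,_; proj₁; proj₂)
open import Data.Sum using (inj₁; inj₂)
open import Data.Vec using (Vec; []; _∷_; lookup; tabulate; sum; count)
open import Data.Vec.Properties using (tabulate-cong)
open import Relation.Binary.PropositionalEquality
  using (_≡_; refl; sym; trans; cong; subst)
open import Relation.Nullary using (Dec; yes; no; ¬_)
open import Relation.Nullary.Decidable using (map′; _×-dec_; _→-dec_; ¬?)
open import Relation.Unary using (Decidable)

private
  variable
    n : ℕ

-- Cars are indexed from 0, by Fin n in order of arrival, but spots from 1, by
-- the natural numbers 1, …, m.

_∈[_] : ℕ → ℕ → Set
p ∈[ m ] = 1 ≤ p × p ≤ m

_∈[_]ⁿ : Vec ℕ n → ℕ → Set
v ∈[ m ]ⁿ = ∀ i → lookup v i ∈[ m ]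

module _ (y : Vec ℕ n) where

  -- In the next three definitions the j-th entry of s is the first spot taken
  -- by car j, so that car j takes the spots s_j, …, s_j + y_j - 1.

  OccupiedBefore : Vec ℕ n → Fin n → ℕ → Set
  OccupiedBefore s i p =
    ∃ λ j → j Fin.< i × lookup s j ≤ p × p < lookup s j + lookup y j

  CanParkAt : Vec ℕ n → Fin n → ℕ → Set
  CanParkAt s i t =
    t + lookup y i ∸ 1 ≤ sum y ×
    (∀ {p} → p < t + lookup y i → t ≤ p → ¬ OccupiedBefore s i p)

  -- Car i, preferring spot x, takes the least admissible start t ≥ x; this is x
  -- itself when the spots x, …, x + y_i - 1 exist and are free.

  ParksFrom : Vec ℕ n → Fin n → ℕ → Set
  ParksFrom s i x =
    x ≤ lookup s i ×
    CanParkAt s i (lookup s i) ×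
    (∀ {t} → t < lookup s i → x ≤ t → ¬ CanParkAt s i t)

  PA : Vec ℕ n → Set
  PA x = x ∈[ sum y ]ⁿ ×
         ∃ λ s → s ∈[ sum y ]ⁿ × (∀ i → ParksFrom s i (lookup x i))

permute : Permutation′ n → Vec ℕ n → Vec ℕ n
permute σ x = tabulate λ i → lookup x (σ ⟨$⟩ʳ i)

PAinv : Vec ℕ n → Vec ℕ n → Set
PAinv y x = PA y x × (∀ σ → PA y (permute σ x))

deg : Vec ℕ n → ℕ
deg = count λ a → ¬? (a ≟ 1)

range : ℕ → List ℕ
range m = List.map suc (List.upTo m)

tuples : ∀ m n → List (Vec ℕ n)
tuples m zero    = [] List.∷ List.[]
tuples m (suc n) = List.cartesianProductWith _∷_ (range m) (tuples m n)

∈-range⁺ : ∀ {m p} → p ∈[ m ] → p ∈ range m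
∈-range⁺ {p = suc p} (_ , p<m) = ∈-map⁺ suc (∈-upTo⁺ p<m)

∈-range⁻ : ∀ {m p} → p ∈ range m → p ∈[ m ]
∈-range⁻ p∈ with ∈-map⁻ suc p∈
... | _ , q∈ , refl = s≤s z≤n , ∈-upTo⁻ q∈

∈-tuples⁺ : ∀ {m} {v : Vec ℕ n} → v ∈[ m ]ⁿ → v ∈ tuples m n
∈-tuples⁺ {v = []}    _  = here refl
∈-tuples⁺ {v = _ ∷ _} v∈ =
  ∈-cartesianProductWith⁺ _∷_ (∈-range⁺ (v∈ zero)) (∈-tuples⁺ (λ i → v∈ (suc i)))

∈-tuples⁻ : ∀ {m} {v : Vec ℕ n} → v ∈ tuples m n → v ∈[ m ]ⁿ
∈-tuples⁻ {n = suc n} {m = m} v∈ i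
  with ∈-cartesianProductWith⁻ _∷_ (range m) (tuples m n) v∈
∈-tuples⁻ _ zero    | _ , _ , a∈ , w∈ , refl = ∈-range⁻ a∈
∈-tuples⁻ _ (suc i) | _ , _ , a∈ , w∈ , refl = ∈-tuples⁻ w∈ i

anyTuple? : ∀ m {P : Vec ℕ n → Set} → Decidable P →
            Dec (∃ λ v → v ∈[ m ]ⁿ × P v)
anyTuple? m P? = map′
  (λ a → let v , v∈ , Pv = find a in v , ∈-tuples⁻ v∈ , Pv)
  (λ (v , v∈ , Pv) → lose (∈-tuples⁺ v∈) Pv)
  (Any.any? P? (tuples m _))

insert-cong : ∀ i j {π ρ : Permutation′ n} →
              π Perm.≈ ρ → insert i j π Perm.≈ insert i j ρ
insert-cong i j π≈ρ k with i Fin.≟ k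
... | yes _   = refl
... | no  i≢k = cong (Fin.punchIn j) (π≈ρ (Fin.punchOut i≢k))

allPermutations? : {P : Permutation′ n → Set} →
                   (∀ {π ρ} → π Perm.≈ ρ → P π → P ρ) →
                   Decidable P → Dec (∀ π → P π)
allPermutations? {zero}  resp P? =
  map′ (λ Pid _ → resp (λ ()) Pid) (λ f → f Perm.id) (P? Perm.id)
allPermutations? {suc n} resp P? = map′
  (λ f π → resp (insert-remove zero π) (f (π ⟨$⟩ʳ zero) (remove zero π)))
  (λ f j π → f (insert zero j π))
  (Fin.all? λ j → allPermutations?
    (λ {π} {ρ} π≈ρ → resp (insert-cong zero j {π} {ρ} π≈ρ))
    (λ π → P? (insert zero j π)))

module _ (y : Vec ℕ n) where

  occupiedBefore? : ∀ s i p → Dec (OccupiedBefore y s i p)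
  occupiedBefore? s i p = Fin.any? λ j →
    (j Fin.<? i) ×-dec (lookup s j ≤? p) ×-dec (p <? lookup s j + lookup y j)

  canParkAt? : ∀ s i t → Dec (CanParkAt y s i t)
  canParkAt? s i t =
    (t + lookup y i ∸ 1 ≤? sum y) ×-dec
    allUpTo? (λ p → (t ≤? p) →-dec ¬? (occupiedBefore? s i p)) (t + lookup y i)

  parksFrom? : ∀ s i x → Dec (ParksFrom y s i x)
  parksFrom? s i x =
    (x ≤? lookup s i) ×-dec
    canParkAt? s i (lookup s i) ×-dec
    allUpTo? (λ t → (x ≤? t) →-dec ¬? (canParkAt? s i t)) (lookup s i)

  PA? : Decidable (PA y)
  PA? x =
    Fin.all? (λ i → (1 ≤? lookup x i) ×-dec (lookup x i ≤? sum y)) ×-dec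
    anyTuple? (sum y) (λ s → Fin.all? λ i → parksFrom? s i (lookup x i))

  PAinv? : Decidable (PAinv y)
  PAinv? x = PA? x ×-dec allPermutations?
    (λ π≈ρ → subst (PA y) (tabulate-cong λ i → cong (lookup x) (π≈ρ i)))
    (λ σ → PA? (permute σ x))

PAinvs : Vec ℕ n → List (Vec ℕ n)
PAinvs {n} y = List.filter (PAinv? y) (tuples (sum y) n)

-- The base value 0 only makes the maximum total: PAinv y contains (1, …, 1)
-- when all lengths are positive, and 0 never exceeds a degree.

χ : Vec ℕ n → ℕ
χ y = Extrema.max 0 (List.map deg (PAinvs y))

∈-PAinvs⁺ : ∀ (y z : Vec ℕ n) → PAinv y z → z ∈ PAinvs y
∈-PAinvs⁺ y z z∈ =
  ∈-filter⁺ (PAinv? y) {x = z} {xs = tuples (sum y) _} (∈-tuples⁺ (proj₁ (proj₁ z∈))) z∈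

∈-PAinvs⁻ : ∀ (y z : Vec ℕ n) → z ∈ PAinvs y → PAinv y z
∈-PAinvs⁻ y z z∈ = proj₂ (∈-filter⁻ (PAinv? y) {v = z} {xs = tuples (sum y) _} z∈)

module _ {A : Set} (f : A → ℕ) where

  ≤-max-map : ∀ {a} (as : List A) → a ∈ as → f a ≤ Extrema.max 0 (List.map f as)
  ≤-max-map as a∈ = ListAll.lookup (Extrema.xs≤max 0 (List.map f as)) (∈-map⁺ f a∈)

  max-map-attained : ∀ {a} (as : List A) → a ∈ as →
                     ∃ λ b → b ∈ as × f b ≡ Extrema.max 0 (List.map f as)
  max-map-attained {a} as a∈ with Extrema.argmax-sel (λ d → d) 0 (List.map f as)
  ... | inj₁ max≡0 =
    a , a∈ , trans (n≤0⇒n≡0 (≤-trans (≤-max-map as a∈) (≤-reflexive max≡0))) (sym max≡0)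
  ... | inj₂ max∈ with ∈-map⁻ f max∈
  ...   | b , b∈ , max≡fb = b , b∈ , sym max≡fb

deg≤χ : ∀ (y z : Vec ℕ n) → PAinv y z → deg z ≤ χ y
deg≤χ y z z∈ = ≤-max-map deg (PAinvs y) (∈-PAinvs⁺ y z z∈)

χ-attained : ∀ (y : Vec ℕ n) → ∃ (PAinv y) → ∃ λ z → PAinv y z × deg z ≡ χ y
χ-attained y (z , z∈) =
  let w , w∈ , eq = max-map-attained deg (PAinvs y) (∈-PAinvs⁺ y z z∈)
  in  w , ∈-PAinvs⁻ y w w∈ , eq

{-# OPTIONS --safe #-}

-- If x is invariant with x_e = 1 its only entry 1, then in every rearrangement
-- the car preferring 1 takes spot 1, since all spots get filled.  Let c be the
-- length of the second car.  Giving it the preference 1 and the first car any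
-- other entry w, so that the first car parks exactly at w, shows w > c; as spot
-- c + 1 is filled, some entry is c + 1.  A car i preferring 1 must then reach
-- spot c, so y_i ≥ c; and if i is not the first car, sending the first car to
-- c + 1 leaves it no more than c spots, so y_i ≤ c.
--
-- Conversely, if y = (a, c, …, c) with a ≥ c then (1, c + 1, …, c + 1) is
-- invariant: the cars preferring c + 1 fill the street from c + 1 on without
-- gaps, and the spots 1, …, c are left for the one preferring 1.

module Submission where

open import Defs
open import Algebra.Properties.CommutativeSemigroup using (interchange)
open import Data.Bool using (if_then_else_)
open import Data.Empty using (⊥-elim)
open import Data.Fin as Fin using (Fin; zero; suc; toℕ; punchIn; punchOut)
open import Data.Fin.Patterns using (0F; 1F)
import Data.Fin.Properties as Fin
open import Data.Fin.Permutation as Perm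
  using (Permutation; Permutation′; _⟨$⟩ʳ_; _⟨$⟩ˡ_; insert; insert-punchIn; inverseʳ; inverseˡ)
import Data.List as List using (map)
import Data.List.Extrema.Nat as Extrema
open import Data.List.Membership.Propositional.Properties using (∈-map⁻)
open import Data.Nat using (ℕ; zero; suc; _+_; _∸_; _≤_; _<_; _≥_; _⊔_; z≤n; s≤s; _≤?_; _<?_; _≟_)
open import Data.Nat.Properties hiding (_≤?_; _<?_; _≟_)
open import Data.Product using (∃; _×_; _,_; proj₁; proj₂)
open import Data.Sum using (inj₁; inj₂; [_,_]′)
open import Data.Vec using (Vec; []; _∷_; lookup; tabulate; sum; count; replicate)
open import Data.Vec.Properties using (lookup∘tabulate; lookup-replicate; count≤n)
open import Function using (_∘_)
open import Function.Bundles using (_⇔_; mk⇔)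
open import Level using (0ℓ)
open import Relation.Binary.Definitions using (tri<; tri≈; tri>)
open import Relation.Binary.PropositionalEquality
  using (_≡_; _≢_; refl; sym; trans; cong; cong₂; subst; subst₂)
open import Relation.Nullary using (Dec; yes; no; ¬_; does; contradiction)
open import Relation.Nullary.Decidable using (_×-dec_; ¬?; decidable-stable; dec-true; dec-false)
open import Relation.Unary using (Pred; Decidable)

private
  variable
    n : ℕ

-- Counting entries of a vector

module _ {A : Set} {P : Pred A 0ℓ} (P? : Decidable P) where

  count≡n⇒all : (xs : Vec A n) → count P? xs ≡ n → ∀ i → P (lookup xs i)
  count≡n⇒all (x ∷ xs) eq i with P? x
  count≡n⇒all (x ∷ xs) eq zero    | yes px = px
  count≡n⇒all (x ∷ xs) eq (suc i) | yes px = count≡n⇒all xs (suc-injective eq) i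
  count≡n⇒all (x ∷ xs) eq i       | no ¬px =
    contradiction (≤-reflexive (sym eq)) (≤⇒≯ (count≤n P? xs))

  count≡n⇒allButOne : (xs : Vec A (suc n)) → count P? xs ≡ n →
                      ∃ λ e → ¬ P (lookup xs e) × (∀ i → i ≢ e → P (lookup xs i))
  count≡n⇒allButOne (x ∷ xs) eq with P? x
  count≡n⇒allButOne (x ∷ xs) eq | no ¬px =
    zero , ¬px , λ { zero i≢e → contradiction refl i≢e
                   ; (suc i) _ → count≡n⇒all xs eq i }
  count≡n⇒allButOne {n = suc n} (x ∷ xs) eq | yes px
    with e , ¬pe , others ← count≡n⇒allButOne xs (suc-injective eq) =
    suc e , ¬pe , λ { zero _ → px ; (suc i) i≢e → others i (i≢e ∘ cong suc) }

  count<n : (xs : Vec A n) (e : Fin n) → ¬ P (lookup xs e) → count P? xs < n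
  count<n (x ∷ xs) e ¬pe with P? x
  count<n (x ∷ xs) zero    ¬pe | yes px = contradiction px ¬pe
  count<n (x ∷ xs) (suc e) ¬pe | yes px = s≤s (count<n xs e ¬pe)
  count<n (x ∷ xs) e       ¬pe | no _   = s≤s (count≤n P? xs)

  count-replicate : ∀ n {a} → P a → count P? (replicate n a) ≡ n
  count-replicate zero        pa = refl
  count-replicate (suc n) {a} pa rewrite dec-true (P? a) pa =
    cong suc (count-replicate n pa)

-- Finite sums

∑ : ℕ → (ℕ → ℕ) → ℕ
∑ zero    f = 0
∑ (suc n) f = ∑ n f + f n

∑-+ : ∀ n f g → ∑ n (λ p → f p + g p) ≡ ∑ n f + ∑ n g
∑-+ zero    f g = refl
∑-+ (suc n) f g rewrite ∑-+ n f g = interchange +-commutativeSemigroup (∑ n f) (∑ n g) (f n) (g n)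

∑-suc : ∀ n f → ∑ (suc n) f ≡ f 0 + ∑ n (f ∘ suc)
∑-suc zero    f = +-comm 0 (f 0)
∑-suc (suc n) f = trans (cong (_+ f (suc n)) (∑-suc n f)) (+-assoc (f 0) _ _)

∑-monoˡ-≤ : ∀ f {m n} → m ≤ n → ∑ m f ≤ ∑ n f
∑-monoˡ-≤ f {m} {zero}  z≤n = z≤n
∑-monoˡ-≤ f {m} {suc n} m≤ with m≤n⇒m<n∨m≡n m≤
... | inj₁ (s≤s m≤n) = ≤-trans (∑-monoˡ-≤ f m≤n) (m≤m+n _ _)
... | inj₂ refl      = ≤-refl

∑-run : ∀ f a l → (∀ {p} → a ≤ p → p < a + l → 1 ≤ f p) → l ≤ ∑ (a + l) f
∑-run f a zero    _   = z≤n
∑-run f a (suc l) f≥1 rewrite +-suc a l = subst (_≤ ∑ (a + l) f + f (a + l)) (+-comm l 1)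
  (+-mono-≤ (∑-run f a l λ a≤p p< → f≥1 a≤p (m≤n⇒m≤1+n p<))
            (f≥1 (m≤m+n a l) ≤-refl))

∑≤n : ∀ n f → (∀ p → f p ≤ 1) → ∑ n f ≤ n
∑≤n zero    f f≤1 = z≤n
∑≤n (suc n) f f≤1 = subst (∑ n f + f n ≤_) (+-comm n 1) (+-mono-≤ (∑≤n n f f≤1) (f≤1 n))

∑<n : ∀ n f {q} → (∀ p → f p ≤ 1) → q < n → f q ≡ 0 → ∑ n f < n
∑<n (suc n) f {q} f≤1 q< fq≡0 with m≤n⇒m<n∨m≡n q<
... | inj₁ (s≤s q<n) =
  subst (suc (∑ n f + f n) ≤_) (+-comm n 1) (+-mono-≤ (∑<n n f f≤1 q<n fq≡0) (f≤1 n))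
... | inj₂ refl rewrite fq≡0 | +-identityʳ (∑ n f) = s≤s (∑≤n n f f≤1)

sum≡∑ : (y : Vec ℕ n) (Y : ℕ → ℕ) → (∀ i → lookup y i ≡ Y (toℕ i)) → sum y ≡ ∑ n Y
sum≡∑ []      Y y≡Y = refl
sum≡∑ {n = suc n} (_ ∷ y) Y y≡Y =
  trans (cong₂ _+_ (y≡Y zero) (sum≡∑ y (Y ∘ suc) (y≡Y ∘ suc))) (sym (∑-suc n Y))

-- Disjoint intervals of total length m inside [m] cover [m]

Covers : (y s : Vec ℕ n) → Fin n → ℕ → Set
Covers y s i p = lookup s i ≤ p × p < lookup s i + lookup y i

covers? : ∀ (y s : Vec ℕ n) i p → Dec (Covers y s i p)
covers? y s i p = (lookup s i ≤? p) ×-dec (p <? lookup s i + lookup y i)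

indicator : ℕ → ℕ → ℕ → ℕ
indicator s l p = if does ((s ≤? p) ×-dec (p <? s + l)) then 1 else 0

indicator-∈ : ∀ {s l p} → s ≤ p × p < s + l → indicator s l p ≡ 1
indicator-∈ {s} {l} {p} p∈ =
  cong (if_then 1 else 0) (dec-true ((s ≤? p) ×-dec (p <? s + l)) p∈)

indicator-∉ : ∀ {s l p} → ¬ (s ≤ p × p < s + l) → indicator s l p ≡ 0
indicator-∉ {s} {l} {p} p∉ =
  cong (if_then 1 else 0) (dec-false ((s ≤? p) ×-dec (p <? s + l)) p∉)

coverCount : (y s : Vec ℕ n) → ℕ → ℕ
coverCount []      []      p = 0
coverCount (l ∷ y) (a ∷ s) p = indicator a l p + coverCount y s p

coverCount≡0 : ∀ (y s : Vec ℕ n) {p} → (∀ i → ¬ Covers y s i p) → coverCount y s p ≡ 0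
coverCount≡0 []      []      _    = refl
coverCount≡0 (l ∷ y) (a ∷ s) none =
  cong₂ _+_ (indicator-∉ (none zero)) (coverCount≡0 y s (none ∘ suc))

coverCount≤1 : ∀ (y s : Vec ℕ n) {p} →
               (∀ {i j} → Covers y s i p → Covers y s j p → i ≡ j) → coverCount y s p ≤ 1
coverCount≤1 []      []      _ = z≤n
coverCount≤1 (l ∷ y) (a ∷ s) {p} unique with (a ≤? p) ×-dec (p <? a + l)
... | yes p∈ rewrite indicator-∈ p∈
                   | coverCount≡0 y s {p} (λ i c → Fin.0≢1+n (unique {zero} {suc i} p∈ c)) = ≤-refl
... | no  p∉ rewrite indicator-∉ p∉ =
  coverCount≤1 y s λ {i} {j} c d → Fin.suc-injective (unique {suc i} {suc j} c d)

-- ∑ runs from 0, so the spots 1, …, m are the successors of its indices.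
≤-∑-indicator : ∀ {a l m} → 1 ≤ a → a + l ≤ suc m → l ≤ ∑ m (indicator a l ∘ suc)
≤-∑-indicator {suc a} {l} _ (s≤s a+l≤m) = ≤-trans
  (∑-run _ a l λ a≤p p< → ≤-reflexive (sym (indicator-∈ {suc a} {l} (s≤s a≤p , s≤s p<))))
  (∑-monoˡ-≤ _ a+l≤m)

-- Double counting: an interval inside the spots 1, ..., `m` adds its whole length to the sum over
-- spots.
sum≤∑-coverCount : ∀ (y s : Vec ℕ n) {m} → (∀ i → 1 ≤ lookup s i) →
                   (∀ i → lookup s i + lookup y i ≤ suc m) →
                   sum y ≤ ∑ m (coverCount y s ∘ suc)
sum≤∑-coverCount []      []      _   _  = z≤n
sum≤∑-coverCount (l ∷ y) (a ∷ s) {m} 1≤s s+y≤ = subst (l + sum y ≤_)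
  (sym (∑-+ m (indicator a l ∘ suc) (coverCount y s ∘ suc)))
  (+-mono-≤ (≤-∑-indicator (1≤s zero) (s+y≤ zero))
            (sum≤∑-coverCount y s (1≤s ∘ suc) (s+y≤ ∘ suc)))

-- An uncovered spot would push the sum of `coverCount` over all spots below `sum y`, since each
-- value is at most 1; double counting forbids this.
covered : ∀ (y s : Vec ℕ n) → (∀ i → 1 ≤ lookup s i) →
          (∀ i → lookup s i + lookup y i ≤ suc (sum y)) →
          (∀ {p i j} → Covers y s i p → Covers y s j p → i ≡ j) →
          ∀ {p} → p ∈[ sum y ] → ∃ λ i → Covers y s i p
covered y s 1≤s s+y≤ unique {suc p} (_ , p<m) with Fin.any? (λ i → covers? y s i (suc p))
... | yes i,c = i,c
... | no none = contradiction (sum≤∑-coverCount y s 1≤s s+y≤)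
  (<⇒≱ (∑<n (sum y) _ (λ q → coverCount≤1 y s unique) p<m
         (coverCount≡0 y s λ i c → none (i , c))))

-- Outcomes of parking

module Outcome (y x : Vec ℕ n) (x∈PA : PA y x) where

  s : Vec ℕ n
  s = proj₁ (proj₂ x∈PA)

  s∈ : s ∈[ sum y ]ⁿ
  s∈ = proj₁ (proj₂ (proj₂ x∈PA))

  parks : ∀ i → ParksFrom y s i (lookup x i)
  parks = proj₂ (proj₂ (proj₂ x∈PA))

  x≤s : ∀ i → lookup x i ≤ lookup s i
  x≤s i = proj₁ (parks i)

  fits : ∀ i → lookup s i + lookup y i ≤ suc (sum y)
  -- `CanParkAt` bounds a truncated difference; adding the 1 back gives a bound free of subtraction.
  fits i = ≤-trans (m≤n+m∸n _ 1) (s≤s (proj₁ (proj₁ (proj₂ (parks i)))))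

  -- Otherwise the later car would have parked on a spot taken by the earlier one.
  covers-unique : ∀ {p i j} → Covers y s i p → Covers y s j p → i ≡ j
  covers-unique {p} {i} {j} (si≤p , p<i) (sj≤p , p<j) with Fin.<-cmp i j
  ... | tri< i<j _ _ =
    ⊥-elim (proj₂ (proj₁ (proj₂ (parks j))) p<j sj≤p (i , i<j , si≤p , p<i))
  ... | tri≈ _ i≡j _ = i≡j
  ... | tri> _ _ j<i =
    ⊥-elim (proj₂ (proj₁ (proj₂ (parks i))) p<i si≤p (j , j<i , sj≤p , p<j))

  spot-covered : ∀ {p} → p ∈[ sum y ] → ∃ λ i → Covers y s i p
  spot-covered = covered y s (proj₁ ∘ s∈) fits covers-unique

first-parks-at-preference : ∀ (y x : Vec ℕ (suc n)) (x∈PA : PA y x) →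
                            lookup (Outcome.s y x x∈PA) 0F ≡ lookup x 0F
first-parks-at-preference y x x∈PA with m≤n⇒m<n∨m≡n (x≤s 0F)
  where open Outcome y x x∈PA
... | inj₂ x≡s = sym x≡s
-- Parking at the preference would end earlier, hence on the street, and no car came before; so `s`
-- would not be minimal.
... | inj₁ x<s = ⊥-elim (proj₂ (proj₂ (parks 0F)) x<s ≤-refl
    ( ≤-trans (∸-monoˡ-≤ 1 (+-monoˡ-≤ (lookup y 0F) (x≤s 0F))) (proj₁ (proj₁ (proj₂ (parks 0F))))
    , λ { _ _ (j , () , _) }))
  where open Outcome y x x∈PA

-- Permutations with prescribed values

insert-≡ : ∀ {m n} i j (π : Permutation m n) → insert i j π ⟨$⟩ʳ i ≡ j
insert-≡ i j π with i Fin.≟ i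
... | yes _   = refl
... | no  i≢i = contradiction refl i≢i

permutation-1 : ∀ (i j : Fin (suc n)) → ∃ λ (σ : Permutation′ (suc n)) → σ ⟨$⟩ʳ i ≡ j
permutation-1 i j = insert i j Perm.id , insert-≡ i j Perm.id

-- The pair `i′ ↦ j′` is realised among the indices left after removing `i` and `j`, and `i ↦ j` is
-- then inserted.
permutation-2 : ∀ {i i′ j j′ : Fin (2 + n)} → i ≢ i′ → j ≢ j′ →
                ∃ λ (σ : Permutation′ (2 + n)) → σ ⟨$⟩ʳ i ≡ j × σ ⟨$⟩ʳ i′ ≡ j′
permutation-2 {i = i} {i′} {j} {j′} i≢i′ j≢j′ =
  insert i j τ , insert-≡ i j τ ,
  trans (cong (insert i j τ ⟨$⟩ʳ_) (sym (Fin.punchIn-punchOut i≢i′)))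
  (trans (insert-punchIn i j τ (punchOut i≢i′))
  (trans (cong (punchIn j) (insert-≡ (punchOut i≢i′) (punchOut j≢j′) Perm.id))
         (Fin.punchIn-punchOut j≢j′)))
  where τ = insert (punchOut i≢i′) (punchOut j≢j′) Perm.id

⟨$⟩ʳ-injective : ∀ (σ : Permutation′ n) {i j} → σ ⟨$⟩ʳ i ≡ σ ⟨$⟩ʳ j → i ≡ j
⟨$⟩ʳ-injective σ eq = trans (sym (inverseˡ σ)) (trans (cong (σ ⟨$⟩ˡ_) eq) (inverseˡ σ))

lookup-permute : ∀ (σ : Permutation′ n) (x : Vec ℕ n) i →
                 lookup (permute σ x) i ≡ lookup x (σ ⟨$⟩ʳ i)
lookup-permute σ x = lookup∘tabulate λ i → lookup x (σ ⟨$⟩ʳ i)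

-- Invariant assortments with a single entry 1

-- The car covering spot 1 starts there, so it cannot prefer a later spot.
PA⇒∃1 : ∀ (y x : Vec ℕ (suc n)) → PA y x → ∃ λ e → lookup x e ≡ 1
PA⇒∃1 y x x∈PA =
  let i , si≤1 , _ = spot-covered (≤-refl , ≤-trans (proj₁ (s∈ 0F)) (proj₂ (s∈ 0F)))
  in  i , ≤-antisym (≤-trans (x≤s i) si≤1) (proj₁ (proj₁ x∈PA i))
  where open Outcome y x x∈PA

module Necessity {k} (y x : Vec ℕ (2 + k)) (1≤y : ∀ i → 1 ≤ lookup y i) (x∈inv : PAinv y x)
                 (e : Fin (2 + k)) (others≢1 : ∀ i → i ≢ e → lookup x i ≢ 1) where

  c : ℕ
  c = lookup y 1F

  -- The rearrangement `σ` hands the entry at `e` to car `i`, so every other car prefers a spot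
  -- beyond 1.
  module Rearranged (σ : Permutation′ (2 + k)) i (σi≡e : σ ⟨$⟩ʳ i ≡ e) where

    open Outcome y (permute σ x) (proj₂ x∈inv σ) public

    x[σj]≤s : ∀ j → lookup x (σ ⟨$⟩ʳ j) ≤ lookup s j
    x[σj]≤s j = subst (_≤ lookup s j) (lookup-permute σ x j) (x≤s j)

    s0≡ : lookup s 0F ≡ lookup x (σ ⟨$⟩ʳ 0F)
    s0≡ = first-parks-at-preference y (permute σ x) (proj₂ x∈inv σ)

    σj≢e : ∀ {j} → j ≢ i → σ ⟨$⟩ʳ j ≢ e
    σj≢e j≢i σj≡e = j≢i (⟨$⟩ʳ-injective σ (trans σj≡e (sym σi≡e)))

    -- Spot 1 is filled, and any car other than `i` starts later.
    si≡1 : lookup s i ≡ 1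
    si≡1 with j , sj≤1 , _ ← spot-covered (≤-refl , ≤-trans (proj₁ (s∈ 0F)) (proj₂ (s∈ 0F)))
         with j Fin.≟ i
    ... | yes refl = ≤-antisym sj≤1 (proj₁ (s∈ i))
    ... | no  j≢i  = contradiction
      (≤-antisym (≤-trans (x[σj]≤s j) sj≤1) (proj₁ (proj₁ (proj₁ x∈inv) _)))
      (others≢1 _ (σj≢e j≢i))

    coversʳ : ∀ {p} → 1 ≤ p → p ≤ lookup y i → Covers y s i p
    coversʳ 1≤p p≤yi rewrite si≡1 = 1≤p , s≤s p≤yi

    coversʳ⁻ : ∀ {p} → Covers y s i p → p ≤ lookup y i
    coversʳ⁻ {p} (_ , p<) = ≤-pred (subst (λ a → p < a + lookup y i) si≡1 p<)

    covers-first : ∀ {p} → lookup x (σ ⟨$⟩ʳ 0F) ≡ p → Covers y s 0F p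
    covers-first {p} xσ0≡p = subst (λ a → a ≤ p × p < a + lookup y 0F) (sym (trans s0≡ xσ0≡p))
      (≤-refl , m<m+n p (1≤y 0F))

  -- With entry `j` given to car 0 and entry `e` to car 1, car 0 parks at `lookup x j`, which must
  -- avoid the spots 1, ..., `c` of car 1.
  c<others : ∀ j → j ≢ e → c < lookup x j
  c<others j j≢e =
    let σ , σ0≡j , σ1≡e = permutation-2 {i = 0F} {i′ = 1F} (λ ()) j≢e
        open Rearranged σ 1F σ1≡e
    in  ≰⇒> λ xj≤c → Fin.0≢1+n (covers-unique
          (covers-first (cong (lookup x) σ0≡j)) (coversʳ (proj₁ (proj₁ (proj₁ x∈inv) j)) xj≤c))

  ∃≡1+c : ∃ λ j → j ≢ e × lookup x j ≡ suc c
  ∃≡1+c =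
    let σ , σ1≡e = permutation-1 1F e
        open Rearranged σ 1F σ1≡e
        -- Spot `suc c` exists because car 0 starts beyond `c`. Car 1 ends at `c`, so another car
        -- covers it.
        j , c∈j  = spot-covered (s≤s z≤n ,
          ≤-trans (≤-trans (c<others _ (σj≢e {0F} λ ())) (x[σj]≤s 0F)) (proj₂ (s∈ 0F)))
        σj≢      = σj≢e λ j≡1 → <-irrefl refl (coversʳ⁻ (subst (λ j → Covers y s j (suc c)) j≡1 c∈j))
    in  σ ⟨$⟩ʳ j , σj≢ , ≤-antisym (≤-trans (x[σj]≤s j) (proj₁ c∈j)) (c<others _ σj≢)

  c≤y : ∀ i → c ≤ lookup y i
  c≤y i =
    let σ , σi≡e      = permutation-1 i e
        j , j≢e , _   = ∃≡1+c
        open Rearranged σ i σi≡e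
        -- Spot `c` is on the street because some entry exceeds `c`; only car `i` can cover it, all
        -- other preferences lying beyond.
        r , sr≤c , c< = spot-covered (1≤y 1F , ≤-trans (<⇒≤ (c<others j j≢e)) (proj₂ (proj₁ (proj₁ x∈inv) j)))
        r≡i           = decidable-stable (r Fin.≟ i) λ r≢i →
          <⇒≱ (c<others _ (σj≢e r≢i)) (≤-trans (x[σj]≤s r) sr≤c)
    in  coversʳ⁻ (subst (λ r → Covers y s r c) r≡i (sr≤c , c<))

  y≤c : ∀ i → lookup y (suc i) ≤ c
  y≤c i =
    let j , j≢e , xj≡1+c = ∃≡1+c
        σ , σ0≡j , σi≡e  = permutation-2 {i = 0F} {i′ = suc i} (λ ()) j≢e
        open Rearranged σ (suc i) σi≡e
    -- If longer than `c`, car `suc i` would share spot `suc c` with car 0.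
    in  ≮⇒≥ λ c<yi → Fin.0≢1+n (covers-unique
          (covers-first (trans (cong (lookup x) σ0≡j) xj≡1+c)) (coversʳ (s≤s z≤n) c<yi))

-- Parking with one preference 1 and all others c + 1

-- Car p prefers 1 and all others prefer c + 1; front i is the first free spot
-- beyond c when car i arrives.  Taking the maximum at car p covers the case
-- p = 0, in which car p is the one reaching beyond c.
module Front (Y : ℕ → ℕ) (c p : ℕ) where

  front : ℕ → ℕ
  front zero    = suc c
  front (suc i) = if does (i ≟ p) then front i ⊔ suc (Y i) else front i + Y i

  start : ℕ → ℕ
  start i = if does (i ≟ p) then 1 else front i

  front-p : front (suc p) ≡ front p ⊔ suc (Y p)
  front-p = cong (if_then front p ⊔ suc (Y p) else front p + Y p) (dec-true (p ≟ p) refl)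

  front-≢ : ∀ {i} → i ≢ p → front (suc i) ≡ front i + Y i
  front-≢ {i} i≢p = cong (if_then front i ⊔ suc (Y i) else front i + Y i) (dec-false (i ≟ p) i≢p)

  start-p : start p ≡ 1
  start-p = cong (if_then 1 else front p) (dec-true (p ≟ p) refl)

  start-≢ : ∀ {i} → i ≢ p → start i ≡ front i
  start-≢ {i} i≢p = cong (if_then 1 else front i) (dec-false (i ≟ p) i≢p)

  front-mono : ∀ {i j} → i ≤ j → front i ≤ front j
  front-mono {i} {zero}  z≤n = ≤-refl
  front-mono {i} {suc j} i≤ with m≤n⇒m<n∨m≡n i≤
  ... | inj₂ refl = ≤-refl
  ... | inj₁ (s≤s i≤j) = ≤-trans (front-mono i≤j) front-step
    where
    front-step : front j ≤ front (suc j)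
    front-step with j ≟ p
    ... | yes refl = subst (front p ≤_) (sym front-p) (m≤m⊔n _ _)
    ... | no  j≢p  = subst (front j ≤_) (sym (front-≢ j≢p)) (m≤m+n _ _)

  c<front : ∀ i → c < front i
  c<front i = front-mono {0} {i} z≤n

  end≤front : ∀ {j i} → j < i → start j + Y j ≤ front i
  end≤front {j} j<i with j ≟ p
  ... | yes refl = ≤-trans
    (subst₂ (λ a b → a + Y p ≤ b) (sym start-p) (sym front-p) (m≤n⊔m _ _)) (front-mono j<i)
  ... | no j≢p = ≤-trans
    (≤-reflexive (trans (cong (_+ Y j) (start-≢ j≢p)) (sym (front-≢ j≢p)))) (front-mono j<i)

  -- By induction on `i`: a spot between two successive fronts belongs to the car that advanced the
  -- front.
  covered-below-front : ∀ i {t} → c < t → t < front i →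
                        ∃ λ j → j < i × start j ≤ t × t < start j + Y j
  covered-below-front zero c<t t<front = contradiction t<front (≤⇒≯ c<t)
  covered-below-front (suc i) {t} c<t t<front with t <? front i
  ... | yes t<  = let j , j<i , t∈ = covered-below-front i c<t t< in j , m<n⇒m<1+n j<i , t∈
  ... | no  t≮ = i , ≤-refl , starts , ends
    where
    starts : start i ≤ t
    starts with i ≟ p
    ... | yes refl = subst (_≤ t) (sym start-p) (≤-trans (s≤s z≤n) c<t)
    ... | no i≢p   = subst (_≤ t) (sym (start-≢ i≢p)) (≮⇒≥ t≮)
    ends : t < start i + Y i
    ends with i ≟ p
    ... | no i≢p   = subst (λ a → t < a + Y i) (sym (start-≢ i≢p)) (subst (t <_) (front-≢ i≢p) t<front)
    -- As `t` is not below `front p`, the maximum in `front-p` can exceed it only through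
    -- `suc (Y p)`.
    ... | yes refl = subst (λ a → t < a + Y p) (sym start-p) (≰⇒> λ Yp<t →
      <⇒≱ (subst (t <_) front-p t<front) (⊔-lub (≮⇒≥ t≮) Yp<t))

  -- The extra `c` allows for the spots 1, ..., `c`, still empty before car `p` arrives.
  front≤1+c+∑ : ∀ i → front i ≤ suc c + ∑ i Y
  front≤1+c+∑ zero = m≤m+n _ _
  front≤1+c+∑ (suc i) with i ≟ p
  ... | yes refl = subst (_≤ suc c + ∑ (suc p) Y) (sym front-p) (⊔-lub
    (≤-trans (front≤1+c+∑ p) (+-monoʳ-≤ (suc c) (m≤m+n _ _)))
    (s≤s (≤-trans (m≤n+m (Y p) (∑ p Y)) (m≤n+m _ c))))
  ... | no i≢p = subst₂ _≤_ (sym (front-≢ i≢p)) (+-assoc (suc c) (∑ i Y) (Y i))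
    (+-monoˡ-≤ (Y i) (front≤1+c+∑ i))

  -- Once car `p` has parked, its length pays for the `c` spots skipped at the start.
  front≤1+∑ : c ≤ Y p → ∀ {i} → p < i → front i ≤ suc (∑ i Y)
  front≤1+∑ c≤Yp {suc i} p<1+i with i ≟ p
  ... | yes refl = subst (_≤ suc (∑ (suc p) Y)) (sym front-p) (⊔-lub
    (≤-trans (front≤1+c+∑ p) (s≤s (subst (_≤ ∑ (suc p) Y) (+-comm (∑ p Y) c) (+-monoʳ-≤ (∑ p Y) c≤Yp))))
    (s≤s (m≤n+m (Y p) (∑ p Y))))
  ... | no i≢p = subst (_≤ suc (∑ (suc i) Y)) (sym (front-≢ i≢p))
    (+-monoˡ-≤ (Y i) (front≤1+∑ c≤Yp (≤∧≢⇒< (≤-pred p<1+i) (i≢p ∘ sym))))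

module _ (Y : ℕ → ℕ) (c : ℕ) (1≤Y : ∀ i → 1 ≤ Y i) (c≤Y : ∀ i → c ≤ Y i)
         (Y≤c : ∀ {i} → 0 < i → Y i ≤ c)
         (y : Vec ℕ n) (y≡Y : ∀ i → lookup y i ≡ Y (toℕ i)) where

  -- Stated for any position `p` of the entry 1, so that it applies to all rearrangements alike.
  PA-one-else-1+c : ∀ (x : Vec ℕ n) (p : Fin n) → lookup x p ≡ 1 →
                    (∀ i → i ≢ p → lookup x i ≡ suc c) → PA y x
  PA-one-else-1+c x p xp≡1 x≡1+c =
    (λ i → 1≤x i , ≤-trans (x≤start i) (start≤ i)) ,
    s , (λ i → subst (_∈[ sum y ]) (sym (s≡ i)) (≤-trans (1≤x i) (x≤start i) , start≤ i)) ,
    parks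
    where
    open Front Y c (toℕ p)

    s = tabulate (start ∘ toℕ)

    s≡ : ∀ i → lookup s i ≡ start (toℕ i)
    s≡ = lookup∘tabulate (start ∘ toℕ)

    1≤x : ∀ i → 1 ≤ lookup x i
    1≤x i with i Fin.≟ p
    ... | yes refl = ≤-reflexive (sym xp≡1)
    ... | no  i≢p  = subst (1 ≤_) (sym (x≡1+c i i≢p)) (s≤s z≤n)

    x≤start : ∀ i → lookup x i ≤ start (toℕ i)
    x≤start i with i Fin.≟ p
    ... | yes refl = ≤-reflexive (trans xp≡1 (sym start-p))
    ... | no  i≢p  = subst₂ _≤_ (sym (x≡1+c i i≢p)) (sym (start-≢ (i≢p ∘ Fin.toℕ-injective)))
                       (c<front (toℕ i))

    end≤1+m : ∀ i → start (toℕ i) + Y (toℕ i) ≤ suc (sum y)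
    end≤1+m i = ≤-trans (end≤front (Fin.toℕ<n i))
      (subst (λ m → front n ≤ suc m) (sym (sum≡∑ y Y y≡Y)) (front≤1+∑ (c≤Y _) (Fin.toℕ<n p)))

    start≤ : ∀ i → start (toℕ i) ≤ sum y
    start≤ i = ≤-pred (≤-trans (m<m+n _ (1≤Y (toℕ i))) (end≤1+m i))

    disjoint : ∀ {i j t} → toℕ j < toℕ i → start (toℕ i) ≤ t → t < start (toℕ i) + Y (toℕ i) →
               ¬ (start (toℕ j) ≤ t × t < start (toℕ j) + Y (toℕ j))
    disjoint {i} {j} {t} j<i si≤t t<i (sj≤t , t<j) with toℕ i ≟ toℕ p
    ... | no i≢p = <⇒≱ t<j (≤-trans (end≤front j<i) (subst (_≤ t) (start-≢ i≢p) si≤t))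
    -- An earlier car exists, so car `p` is not the first and has length at most `c`; the earlier
    -- car starts beyond `c`.
    ... | yes i≡p = <⇒≱ (subst (λ q → t < q + Y (toℕ i)) (trans (cong start i≡p) start-p) t<i)
      (≤-trans (s≤s (Y≤c (≤-<-trans z≤n j<i)))
      (≤-trans (c<front (toℕ j))
      (subst (_≤ t) (start-≢ (<⇒≢ (subst (toℕ j <_) i≡p j<i))) sj≤t)))

    parks : ∀ i → ParksFrom y s i (lookup x i)
    parks i rewrite s≡ i =
      x≤start i ,
      ( ∸-monoˡ-≤ 1 (subst (λ l → start (toℕ i) + l ≤ _) (sym (y≡Y i)) (end≤1+m i))
      , λ { t<i si≤t (j , j<i , t∈j) → disjoint j<i si≤t (subst (λ l → _ < start (toℕ i) + l) (y≡Y i) t<i)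
              (subst₂ (λ a l → a ≤ _ × _ < a + l) (s≡ j) (y≡Y j) t∈j) }) ,
      blocked
      where
      blocked : ∀ {t} → t < start (toℕ i) → lookup x i ≤ t → ¬ CanParkAt y s i t
      blocked {t} t<si xi≤t (_ , free) with i Fin.≟ p
      ... | yes refl = <⇒≱ (subst (t <_) start-p t<si) (subst (_≤ t) xp≡1 xi≤t)
      -- The single spot `t` is already taken: the stretch from `suc c` to the front has no gaps.
      ... | no i≢p
        with j , j<i , t∈j ← covered-below-front (toℕ i) (subst (_≤ t) (x≡1+c i i≢p) xi≤t)
                               (subst (t <_) (start-≢ (i≢p ∘ Fin.toℕ-injective)) t<si)
        = free (m<m+n t (subst (1 ≤_) (sym (y≡Y i)) (1≤Y _))) ≤-refl
            ( j′ , subst (_< toℕ i) (sym j′≡j) j<i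
            , subst₂ (λ a l → a ≤ t × t < a + l)
                (sym (trans (s≡ j′) (cong start j′≡j)))
                (sym (trans (y≡Y j′) (cong Y j′≡j))) t∈j)
        where
        j′   = Fin.fromℕ< (<-trans j<i (Fin.toℕ<n i))
        j′≡j = Fin.toℕ-fromℕ< (<-trans j<i (Fin.toℕ<n i))

PAinv-one-else-1+c : ∀ {k} (y : Vec ℕ (2 + k)) → (∀ i → 1 ≤ lookup y i) →
                     lookup y 0F ≥ lookup y 1F → (∀ i → lookup y (suc i) ≡ lookup y 1F) →
                     PAinv y (1 ∷ replicate (suc k) (suc (lookup y 1F)))
PAinv-one-else-1+c {k} y 1≤y y0≥y1 ysuc≡y1 =
  pa z 0F refl z≡1+c ,
  -- `σ ⟨$⟩ˡ 0F` is the car to which `σ` gives the entry 1.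
  λ σ → pa (permute σ z) (σ ⟨$⟩ˡ 0F)
    (trans (lookup-permute σ z (σ ⟨$⟩ˡ 0F)) (cong (lookup z) (inverseʳ σ {0F})))
    (λ i i≢ → trans (lookup-permute σ z i)
      (z≡1+c (σ ⟨$⟩ʳ i) λ σi≡0 → i≢ (trans (sym (inverseˡ σ)) (cong (σ ⟨$⟩ˡ_) σi≡0))))
  where
  c = lookup y 1F
  z = 1 ∷ replicate (suc k) (suc c)

  Y : ℕ → ℕ
  Y zero    = lookup y 0F
  Y (suc _) = c

  z≡1+c : ∀ i → i ≢ 0F → lookup z i ≡ suc c
  z≡1+c zero    i≢0 = contradiction refl i≢0
  z≡1+c (suc i) _   = lookup-replicate i (suc c)

  pa : ∀ (x : Vec ℕ (2 + k)) p → lookup x p ≡ 1 →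
       (∀ i → i ≢ p → lookup x i ≡ suc c) → PA y x
  pa = PA-one-else-1+c Y c
    (λ { zero → 1≤y 0F ; (suc _) → 1≤y 1F })
    (λ { zero → y0≥y1 ; (suc _) → ≤-refl })
    (λ { {suc _} _ → ≤-refl })
    y (λ { zero → refl ; (suc i) → ysuc≡y1 i })

-- Degrees and the characteristic

deg<n : ∀ (y x : Vec ℕ (suc n)) → PA y x → deg x < suc n
deg<n y x x∈PA = let e , xe≡1 = PA⇒∃1 y x x∈PA in count<n _ x e λ xe≢1 → xe≢1 xe≡1

-- A positive maximum is not the base value 0, so it is attained without first exhibiting an
-- invariant assortment.
χ>0⇒attained : ∀ (y : Vec ℕ n) → 0 < χ y → ∃ λ z → PAinv y z × deg z ≡ χ y
χ>0⇒attained y χ>0 = [ (λ χ≡0 → contradiction (sym χ≡0) (<⇒≢ χ>0))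
                     , (λ χ∈ → let z , z∈ , χ≡ = ∈-map⁻ deg χ∈ in z , ∈-PAinvs⁻ y z z∈ , sym χ≡) ]′
  (Extrema.argmax-sel (λ d → d) 0 (List.map deg (PAinvs y)))

theorem2 : ∀ (k : ℕ) (y : Vec ℕ (2 + k)) →
    (∀ i → 1 ≤ lookup y i) →
    (χ y ≡ (2 + k) ∸ 1) ⇔
    (lookup y 0F ≥ lookup y 1F × (∀ i → lookup y (suc i) ≡ lookup y 1F))
theorem2 k y 1≤y = mk⇔ necessary sufficient
  where
  necessary : χ y ≡ suc k → lookup y 0F ≥ lookup y 1F × (∀ i → lookup y (suc i) ≡ lookup y 1F)
  necessary χ≡ =
    let x , x∈inv , deg≡χ = χ>0⇒attained y (subst (0 <_) (sym χ≡) (s≤s z≤n))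
        -- A degree one short of the number of cars leaves a single exceptional index `e`.
        e , _ , others≢1  = count≡n⇒allButOne _ x (trans deg≡χ χ≡)
        open Necessity y x 1≤y x∈inv e others≢1
    in  c≤y 0F , λ i → ≤-antisym (y≤c i) (c≤y (suc i))

  sufficient : lookup y 0F ≥ lookup y 1F × (∀ i → lookup y (suc i) ≡ lookup y 1F) → χ y ≡ suc k
  sufficient (y0≥y1 , ysuc≡y1) =
    let z∈             = PAinv-one-else-1+c y 1≤y y0≥y1 ysuc≡y1
        -- `z` guarantees that the maximum is attained, at `w`; the degree of `w` is bounded above
        -- by `deg<n`, and that of `z` bounds the maximum below.
        w , w∈ , deg≡χ = χ-attained y (z , z∈)
    in  ≤-antisym (subst (_≤ suc k) deg≡χ (≤-pred (deg<n y w (proj₁ w∈))))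
                  (subst (_≤ χ y) deg≡1+k (deg≤χ y z z∈))
    where
    z = 1 ∷ replicate (suc k) (suc (lookup y 1F))
    deg≡1+k : deg z ≡ suc k
    deg≡1+k = count-replicate (λ a → ¬? (a ≟ 1)) (suc k) λ eq → <⇒≢ (1≤y 1F) (sym (suc-injective eq))
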